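{- Let $k \geq 2$, $0 \leq j \leq k-1$, and $n = a(k+1) + r \geq 0$ with integers $a$ and $r$, $-1 \leq r \leq k-1$. (i) If $r=-1$ or $r=j$, then $v_2(B_n(k,j)) = 0$. (ii) If $0 \leq r \leq j-1$, $a \geq 2$, $\Delta_1 > 0$ and $\Delta_2 > 0$, then $$v_2(B_n(k,j)) = r+1+ v_2 \left( \binom{a + r}{a-1} \right).$$ (iii) If $j+1 \leq r \leq k-1$, $a \geq 1$, $\Delta_3 >0$ and $\Delta_4 >0$, then $$v_2(B_n(k,j)) = r-j+ v_2 \left( \binom{a+ r-j-1}{a-1} \right).$$
   Context: For integers $k \geq 2$ and $0 \leq j \leq k-1$, the sequence $\{B_n(k,j)\}_{n\geq 0}$ is defined by the recurrence $B_n(k,j) = B_{n-1}(k,j) + B_{n-2}(k,j)+\dots+B_{n-k}(k,j)$ for all $n \geq k$, with initial values $B_j(k,j)=1$ and $B_i(k,j)=0$ for $0 \leq i \leq k-1$, $i \neq j$. $v_2$ denotes the 2-adic order (2-adic valuation), with $v_2(0)=+\infty$. With $n = a(k+1)+r$, $-1 \leq r \leq k-1$, define: if $-1 \leq r \leq j-1$ and $a \geq 2$, $$\Delta_1 = (r+k+2) - v_2 \left( \binom{a+r}{a-1} 2^{r+1} \right),$$ $$\Delta_2 = v_2 \left( \binom{a + r+k-j-1}{a-2} 2^{r+k+1-j} \right) - v_2 \left( \binom{a+r}{a-1} 2^{r+1} \right);$$ if $j \leq r \leq k-1$ (and $a \geq 1$), $$\Delta_3 = (r+k+1-j)- v_2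 \left( \binom{a+ r-j-1}{a-1} 2^{r-j} \right),$$ $$\Delta_4 = v_2 \left( \binom{a+ r}{a-1} 2^{r+1} \right) - v_2 \left( \binom{a+ r-j-1}{a-1} 2^{r-j} \right).$$ -}

module Defs where

open import Data.Bool.Base using (if_then_else_)
open import Data.Integer.Base as ℤ using (ℤ; +_; -[1+_]; 0ℤ; 1ℤ; ∣_∣; _+_; _-_)
open import Data.List.Base using (List; []; _∷_; take)
open import Data.Nat.Base as ℕ using (ℕ; zero; suc)
open import Data.Nat.Combinatorics using (_C_)
open import Data.Nat.Divisibility using (_∣?_)
open import Data.Nat.ListAction using (sum)
import Data.Nat.Properties as ℕ
open import Relation.Binary.Construct.Add.Extrema.Strict ℤ._<_ using (_<±_)
open import Relation.Nullary.Construct.Add.Extrema using (_±; ⊥±; ⊤±)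
  renaming ([_] to [_]±)
open import Relation.Nullary.Construct.Add.Supremum using (_⁺; ⊤⁺; [_])
open import Relation.Nullary.Decidable using (does)

mutual
  B : (k j n : ℕ) → ℕ
  B k j n =
    if does (n ℕ.<? k)
    then (if does (n ℕ.≟ j) then 1 else 0)
    else sum (take k (previous k j n))

  -- B k j (n - 1) ∷ B k j (n - 2) ∷ … ∷ B k j 0 ∷ []
  previous : (k j n : ℕ) → List ℕ
  previous k j zero    = []
  previous k j (suc n) = B k j n ∷ previous k j n

-- The greatest e ≤ b such that 2 ^ e divides m.
greatestExponent : (m b : ℕ) → ℕ
greatestExponent m zero    = zero
greatestExponent m (suc b) =
  if does ((2 ℕ.^ suc b) ∣? m) then suc b else greatestExponent m b

-- The bound m loses nothing: if 2 ^ e divides m > 0, then e < 2 ^ e ≤ m.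
-- Values are taken in ℤ ∪ {+∞}, so that they combine with integer indices.
v₂ : ℕ → ℤ ⁺
v₂ zero      = ⊤⁺
v₂ m@(suc _) = [ + greatestExponent m m ]

infixl 6 _+⁺_ _-⁺_

_+⁺_ : ℤ ⁺ → ℤ ⁺ → ℤ ⁺
[ x ] +⁺ [ y ] = [ x + y ]
[ _ ] +⁺ ⊤⁺    = ⊤⁺
⊤⁺    +⁺ _     = ⊤⁺

-- The last clause includes the meaningless ∞ - ∞; it is never reached from
-- Δ₁, …, Δ₄ in their ranges of definition, where all binomial coefficients
-- are positive.
_-⁺_ : ℤ ⁺ → ℤ ⁺ → ℤ ±
[ x ] -⁺ [ y ] = [ x - y ]±
⊤⁺    -⁺ [ _ ] = ⊤±
_     -⁺ ⊤⁺    = ⊥±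

Positive : ℤ ± → Set
Positive x = [ 0ℤ ]± <± x

-- Only used with x ≥ 0; the last clause is a dummy value.
binom : (x y : ℤ) → ℕ
binom (+ n)    (+ m)    = n C m
binom (+ _)    -[1+ _ ] = 0
binom -[1+ _ ] _        = 0

-- Only used with e ≥ 0.
2^_ : ℤ → ℕ
2^ e = 2 ℕ.^ ∣ e ∣

infixr 8 2^_

module _ (k j : ℕ) (a r : ℤ) where

  -- Δ₁ and Δ₂ are meant for -1 ≤ r ≤ j - 1 and a ≥ 2.

  Δ₁ : ℤ ±
  Δ₁ = [ r + + k + + 2 ]
    -⁺ v₂ (binom (a + r) (a - 1ℤ) ℕ.* 2^ (r + 1ℤ))

  Δ₂ : ℤ ±
  Δ₂ = v₂ (binom (a + r + + k - + j - 1ℤ) (a - + 2) ℕ.* 2^ (r + + k + 1ℤ - + j))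
    -⁺ v₂ (binom (a + r) (a - 1ℤ) ℕ.* 2^ (r + 1ℤ))

  -- Δ₃ and Δ₄ are meant for j ≤ r ≤ k - 1 and a ≥ 1.

  Δ₃ : ℤ ±
  Δ₃ = [ r + + k + 1ℤ - + j ]
    -⁺ v₂ (binom (a + r - + j - 1ℤ) (a - 1ℤ) ℕ.* 2^ (r - + j))

  Δ₄ : ℤ ±
  Δ₄ = v₂ (binom (a + r) (a - 1ℤ) ℕ.* 2^ (r + 1ℤ))
    -⁺ v₂ (binom (a + r - + j - 1ℤ) (a - 1ℤ) ℕ.* 2^ (r - + j))

module Submission where

-- With G the power series 1 / (1 - 2 x + x ^ (k + 1)), the generating function
-- of B_n(k, j) is x ^ j + (x ^ k - x ^ (j + k + 1)) G. Writing m = a (k + 1) + r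
-- with 0 ≤ r ≤ k, the coefficient of x ^ m in G is (-1) ^ a C(a + r, a) 2 ^ r
-- modulo 2 ^ (r + k + 1), since each further term of the expansion of G carries
-- another k + 1 factors of 2. So B_n is, up to signs, a difference of two explicit
-- terms modulo a power of 2, and positivity of the Δs says that one of the two
-- has strictly smaller order than both the other one and the modulus.

open import Defs
open import Data.Bool.Base using (if_then_else_)
open import Data.Integer using (ℤ; +_; -[1+_]; 0ℤ; 1ℤ; -1ℤ; _+_; _-_; -_; _*_; _^_; ∣_∣; _≤_)
import Data.Integer as ℤ
open import Data.Integer.Divisibility.Signed as Signed using (divides) renaming (_∣_ to _∣ℤ_)
import Data.Integer.Properties as ℤ
open import Data.Integer.Tactic.RingSolver using (solve-∀)
open import Data.List.Base using (take)
open import Data.Nat using (ℕ; zero; suc) renaming (_≤_ to _≤ℕ_; _<_ to _<ℕ_)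
import Data.Nat as ℕ
open import Data.Nat.Combinatorics using (_C_; nCn≡1; nCk+nC[k+1]≡[n+1]C[k+1])
open import Data.Nat.Divisibility as ℕ∣ using (_∣_; _∣?_; _∤_)
open import Data.Nat.Induction using (<-rec)
open import Data.Nat.ListAction using (sum)
import Data.Nat.Properties as ℕ
open import Data.Nat.Solver using (module +-*-Solver)
open import Data.Product using (_×_; _,_; ∃-syntax; proj₁; proj₂)
open import Data.Sum using (_⊎_; inj₁; inj₂)
open import Function using (_∘_)
open import Relation.Binary.Definitions using (tri<; tri≈; tri>)
import Relation.Binary.Construct.Add.Extrema.Strict ℤ._<_ as Extrema
import Relation.Binary.Construct.Add.Supremum.Strict as Supremum
open import Relation.Binary.PropositionalEquality
open import Relation.Nullary using (yes; no; contradiction)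
open import Relation.Nullary.Construct.Add.Supremum using ([_])
open import Relation.Nullary.Decidable using (does; dec-true; dec-false; from-no)

-- The generating function

δ : ℕ → ℕ → ℕ
δ n j = if does (n ℕ.≟ j) then 1 else 0

δ-diag : ∀ n → δ n n ≡ 1
δ-diag n rewrite dec-true (n ℕ.≟ n) refl = refl

δ-off : ∀ {n j} → n ≢ j → δ n j ≡ 0
δ-off {n} {j} n≢j rewrite dec-false (n ℕ.≟ j) n≢j = refl

B-initial : ∀ {k} j {n} → n <ℕ k → B k j n ≡ δ n j
B-initial {k} j {n} n<k rewrite dec-true (n ℕ.<? k) n<k = refl

B-recurrence : ∀ {k} j {n} → k ≤ℕ n → B k j n ≡ sum (take k (previous k j n))
B-recurrence {k} j {n} k≤n rewrite dec-false (n ℕ.<? k) (ℕ.≤⇒≯ k≤n) = refl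

-- `previous k j (suc (m + n))` starts with the value at `m + n`, so its entry number `m`, counted
-- from 0, is the value at `n`. Peeling it off lines up the windows of two consecutive recurrences.
sum-take-suc : ∀ k j m n →
  sum (take (suc m) (previous k j (suc (m ℕ.+ n)))) ≡
  sum (take m (previous k j (suc (m ℕ.+ n)))) ℕ.+ B k j n
sum-take-suc k j zero    n = ℕ.+-identityʳ (B k j n)
sum-take-suc k j (suc m) n =
  trans (cong (B k j (suc (m ℕ.+ n)) ℕ.+_) (sum-take-suc k j m n))
        (sym (ℕ.+-assoc (B k j (suc (m ℕ.+ n))) _ (B k j n)))

-- Subtracting two consecutive instances of the recurrence.
B-doubling : ∀ k j n → 0 <ℕ k → B k j (suc k ℕ.+ n) ℕ.+ B k j n ≡ 2 ℕ.* B k j (k ℕ.+ n)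
B-doubling (suc k) j n _ = begin
  B′ (suc (suc k ℕ.+ n)) ℕ.+ B′ n
    ≡⟨ cong (ℕ._+ B′ n) (B-recurrence j (ℕ.≤-trans (ℕ.m≤m+n (suc k) n) (ℕ.n≤1+n _))) ⟩
  B′ (suc k ℕ.+ n) ℕ.+ S ℕ.+ B′ n
    ≡⟨ ℕ.+-assoc (B′ (suc k ℕ.+ n)) S (B′ n) ⟩
  B′ (suc k ℕ.+ n) ℕ.+ (S ℕ.+ B′ n)
    ≡⟨ cong (B′ (suc k ℕ.+ n) ℕ.+_) (sum-take-suc (suc k) j k n) ⟨
  B′ (suc k ℕ.+ n) ℕ.+ sum (take (suc k) (previous (suc k) j (suc k ℕ.+ n)))
    ≡⟨ cong (B′ (suc k ℕ.+ n) ℕ.+_) (B-recurrence j (ℕ.m≤m+n (suc k) n)) ⟨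
  B′ (suc k ℕ.+ n) ℕ.+ B′ (suc k ℕ.+ n)
    ≡⟨ cong (B′ (suc k ℕ.+ n) ℕ.+_) (ℕ.+-identityʳ _) ⟨
  2 ℕ.* B′ (suc k ℕ.+ n) ∎
  where
  open ≡-Reasoning
  B′ = B (suc k) j
  S  = sum (take k (previous (suc k) j (suc k ℕ.+ n)))

sum-initial-below : ∀ {k j} m → m ≤ℕ j → j <ℕ k → sum (take m (previous k j m)) ≡ 0
sum-initial-below zero    _   _   = refl
sum-initial-below {k} {j} (suc m) m<j j<k =
  cong₂ ℕ._+_ (trans (B-initial j (ℕ.<-trans m<j j<k)) (δ-off (ℕ.<⇒≢ m<j)))
              (sum-initial-below m (ℕ.<⇒≤ m<j) j<k)

sum-initial-above : ∀ {k j} d → d ℕ.+ j <ℕ k →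
  sum (take (suc (d ℕ.+ j)) (previous k j (suc (d ℕ.+ j)))) ≡ 1
sum-initial-above {k} {j} zero    j<k =
  cong₂ ℕ._+_ (trans (B-initial j j<k) (δ-diag j)) (sum-initial-below j ℕ.≤-refl j<k)
sum-initial-above {k} {j} (suc d) d<k =
  cong₂ ℕ._+_ (trans (B-initial j d<k) (δ-off (ℕ.m+1+n≢n d ∘ trans (ℕ.+-suc d j))))
              (sum-initial-above d (ℕ.<-trans ℕ.≤-refl d<k))

-- The k terms summed at `n = k` are exactly the initial values, just one of which is 1.
B-at-k : ∀ {k j} → j <ℕ k → B k j k ≡ 1
B-at-k {k} {j} j<k with d , refl ← ℕ.m≤n⇒∃[o]m+o≡n j<k =
  trans (B-recurrence {k} j ℕ.≤-refl)
    (subst (λ m → sum (take (suc m) (previous k j (suc m))) ≡ 1) (ℕ.+-comm d j)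
      (sum-initial-above d (ℕ.≤-reflexive (cong suc (ℕ.+-comm d j)))))

-- g k n i is the coefficient of x ^ (n ∸ i) in 1 / (1 - 2 x + x ^ (k + 1)),
-- and 0 if i > n.
g : ℕ → ℕ → ℕ → ℤ
g k zero    zero    = 1ℤ
g k zero    (suc i) = 0ℤ
g k (suc n) zero    = + 2 * g k n 0 - g k n k
g k (suc n) (suc i) = g k n i

-- Only the difference of the two indices matters. Keeping both gives coefficients of negative index
-- the value 0, which truncated subtraction would not.
g-shift : ∀ k d n i → g k (d ℕ.+ n) (d ℕ.+ i) ≡ g k n i
g-shift k zero    n i = refl
g-shift k (suc d) n i = g-shift k d n i

g-vanishes : ∀ k {n i} → n <ℕ i → g k n i ≡ 0ℤ
g-vanishes k {zero}  {suc i} _           = refl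
g-vanishes k {suc n} {suc i} (ℕ.s<s n<i) = g-vanishes k n<i

-- This compares coefficients in (1 - 2 x + x ^ (k + 1)) G = 1. The `δ` is the constant term 1,
-- which enters when `i = suc n`.
g-step : ∀ k n i → g k (suc n) i ≡ + 2 * g k n i - g k n (i ℕ.+ k) + + δ i (suc n)
g-step k n       zero          = sym (ℤ.+-identityʳ _)
g-step k zero    (suc zero)    = refl
g-step k zero    (suc (suc i)) = refl
g-step k (suc n) (suc i)       = g-step k n i

-- `g-step` rewritten in the shape of `B-doubling`, so that both sides of `B-closed` obey comparable
-- recurrences.
g-doubling : ∀ k n i →
  g k (suc k ℕ.+ n) i + g k n i ≡ + 2 * g k (k ℕ.+ n) i + + δ i (suc k ℕ.+ n)
g-doubling k n i = begin
  g k (suc k ℕ.+ n) i + g k n i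
    ≡⟨ cong₂ _+_ (g-step k (k ℕ.+ n) i)
                 (sym (trans (cong (g k (k ℕ.+ n)) (ℕ.+-comm i k)) (g-shift k k n i))) ⟩
  + 2 * g k (k ℕ.+ n) i - y + z + y
    ≡⟨ cancel (+ 2 * g k (k ℕ.+ n) i) y z ⟩
  + 2 * g k (k ℕ.+ n) i + z ∎
  where
  open ≡-Reasoning
  y = g k (k ℕ.+ n) (i ℕ.+ k)
  z = + δ i (suc k ℕ.+ n)
  cancel : ∀ x y z → x - y + z + y ≡ x + z
  cancel = solve-∀

-- Both sides agree for `n ≤ k`, and from `k + 1` on the doubling recurrence propagates the
-- equality.
B-closed : ∀ {k j} → j <ℕ k → ∀ n →
  + B k j n ≡ + δ n j + g k n k - g k n (suc k ℕ.+ j)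
B-closed {k} {j} j<k = <-rec _ step
  where
  open ≡-Reasoning
  P : ℕ → Set
  P n = + B k j n ≡ + δ n j + g k n k - g k n (suc k ℕ.+ j)

  δ-high : ∀ n → δ (k ℕ.+ n) j ≡ 0
  δ-high n = δ-off (ℕ.>⇒≢ (ℕ.<-≤-trans j<k (ℕ.m≤m+n k n)))

  δ-transpose : ∀ n → δ (suc k ℕ.+ j) (suc k ℕ.+ n) ≡ δ n j
  δ-transpose n = go (suc k)
    where
    δ-comm : ∀ m n → δ m n ≡ δ n m
    δ-comm zero    zero    = refl
    δ-comm zero    (suc n) = refl
    δ-comm (suc m) zero    = refl
    δ-comm (suc m) (suc n) = δ-comm m n
    go : ∀ d → δ (d ℕ.+ j) (d ℕ.+ n) ≡ δ n j
    go zero    = δ-comm j n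
    go (suc d) = go d

  late : ∀ n → P n → P (k ℕ.+ n) → P (suc k ℕ.+ n)
  late n Pn Pkn = begin
    + B k j (suc k ℕ.+ n)
      ≡⟨ add-sub (+ B k j (suc k ℕ.+ n)) (+ B k j n) ⟩
    + (B k j (suc k ℕ.+ n) ℕ.+ B k j n) - + B k j n
      ≡⟨ cong (λ b → + b - + B k j n) (B-doubling k j n (ℕ.≤-<-trans ℕ.z≤n j<k)) ⟩
    + (2 ℕ.* B k j (k ℕ.+ n)) - + B k j n
      ≡⟨ cong (_- + B k j n) (ℤ.pos-* 2 (B k j (k ℕ.+ n))) ⟩
    + 2 * + B k j (k ℕ.+ n) - + B k j n
      ≡⟨ cong₂ (λ x y → + 2 * x - y)
           (trans Pkn (cong (λ e → + e + p - q) (δ-high n))) Pn ⟩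
    + 2 * (0ℤ + p - q) - (+ δ n j + u - v)
      ≡⟨ regroup p q u v (+ δ n j) ⟩
    + 2 * p + 0ℤ - u - (+ 2 * q + + δ n j - v)
      -- The `δ n j` brought in by `Pn` is exactly the correction in `g-doubling` at `suc k + j`;
      -- the correction at `k` is zero.
      ≡⟨ cong₂ (λ x y → + 2 * p + + x - u - (+ 2 * q + + y - v))
           (δ-off (ℕ.<⇒≢ (ℕ.s≤s (ℕ.m≤m+n k n)))) (δ-transpose n) ⟨
    + 2 * p + + δ k (suc k ℕ.+ n) - u - (+ 2 * q + + δ (suc k ℕ.+ j) (suc k ℕ.+ n) - v)
      ≡⟨ cong₂ (λ x y → x - u - (y - v))
           (g-doubling k n k) (g-doubling k n (suc k ℕ.+ j)) ⟨
    p′ + u - u - (q′ + v - v)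
      ≡⟨ cancel p′ u q′ v ⟩
    0ℤ + p′ - q′
      ≡⟨ cong (λ e → + e + p′ - q′)
           (trans (cong (λ m → δ m j) (sym (ℕ.+-suc k n))) (δ-high (suc n))) ⟨
    + δ (suc k ℕ.+ n) j + p′ - q′ ∎
    where
    p  = g k (k ℕ.+ n) k
    q  = g k (k ℕ.+ n) (suc k ℕ.+ j)
    u  = g k n k
    v  = g k n (suc k ℕ.+ j)
    p′ = g k (suc k ℕ.+ n) k
    q′ = g k (suc k ℕ.+ n) (suc k ℕ.+ j)
    add-sub : ∀ x y → x ≡ x + y - y
    add-sub = solve-∀
    regroup : ∀ p q u v e →
      + 2 * (0ℤ + p - q) - (e + u - v) ≡ + 2 * p + 0ℤ - u - (+ 2 * q + e - v)
    regroup = solve-∀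
    cancel : ∀ p u q v → p + u - u - (q + v - v) ≡ 0ℤ + p - q
    cancel = solve-∀

  step : ∀ n → (∀ {m} → m <ℕ n → P m) → P n
  step n rec with ℕ.<-cmp n k
  ... | tri< n<k _ _
    rewrite B-initial j n<k
          | g-vanishes k n<k
          | g-vanishes k (ℕ.<-≤-trans n<k (ℕ.m≤n⇒m≤1+n (ℕ.m≤m+n k j)))
    = add-zeros (+ δ n j)
    where
    add-zeros : ∀ x → x ≡ x + 0ℤ - 0ℤ
    add-zeros = solve-∀
  -- The doubling recurrence first applies at `k + 1`, so `n = k` is still a base case.
  ... | tri≈ _ refl _
    rewrite B-at-k j<k
          | δ-off (ℕ.>⇒≢ j<k)
          | g-vanishes k (ℕ.s≤s (ℕ.m≤m+n k j))
          | subst (λ i → g k i i ≡ 1ℤ) (ℕ.+-identityʳ k) (g-shift k k 0 0)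
    = refl
  ... | tri> _ _ k<n with m , refl ← ℕ.m≤n⇒∃[o]m+o≡n k<n =
    late m (rec (ℕ.s≤s (ℕ.m≤n+m m k))) (rec ℕ.≤-refl)

-- Coefficients of G modulo powers of 2

2^-mono-∣ : ∀ {m n} → m ≤ℕ n → 2 ℕ.^ m ∣ 2 ℕ.^ n
2^-mono-∣ {m} m≤n with o , refl ← ℕ.m≤n⇒∃[o]m+o≡n m≤n =
  subst (2 ℕ.^ m ∣_) (sym (ℕ.^-distribˡ-+-* 2 m o)) (ℕ∣.m∣m*n (2 ℕ.^ o))

infix 4 _≡_[mod2^_]

-- A record rather than a synonym, so that unification can read `x`, `y` and `e` off the type.
record _≡_[mod2^_] (x y : ℤ) (e : ℕ) : Set where
  constructor congruent
  field divides-difference : + (2 ℕ.^ e) ∣ℤ x - y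

mod-reflexive : ∀ {x y e} → x ≡ y → x ≡ y [mod2^ e ]
mod-reflexive {x} {e = e} refl =
  congruent (subst (+ (2 ℕ.^ e) ∣ℤ_) (sym (ℤ.+-inverseʳ x)) (divides 0ℤ refl))

mod-trans : ∀ {x y z e} → x ≡ y [mod2^ e ] → y ≡ z [mod2^ e ] → x ≡ z [mod2^ e ]
mod-trans {x} {y} {z} {e} (congruent p) (congruent q) =
  congruent (subst (+ (2 ℕ.^ e) ∣ℤ_) (telescope x y z) (Signed.∣m∣n⇒∣m+n p q))
  where
  telescope : ∀ x y z → x - y + (y - z) ≡ x - z
  telescope = solve-∀

mod-weaken : ∀ {x y m n} → m ≤ℕ n → x ≡ y [mod2^ n ] → x ≡ y [mod2^ m ]
mod-weaken m≤n (congruent p) = congruent (Signed.∣-trans (Signed.∣ᵤ⇒∣ (2^-mono-∣ m≤n)) p)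

mod-minus : ∀ {x x′ y y′ e} → x ≡ x′ [mod2^ e ] → y ≡ y′ [mod2^ e ] →
  x - y ≡ x′ - y′ [mod2^ e ]
mod-minus {x} {x′} {y} {y′} {e} (congruent p) (congruent q) =
  congruent (subst (+ (2 ℕ.^ e) ∣ℤ_) (regroup x x′ y y′) (Signed.∣m∣n⇒∣m-n p q))
  where
  regroup : ∀ x x′ y y′ → x - x′ - (y - y′) ≡ x - y - (x′ - y′)
  regroup = solve-∀

-- Doubling gains one power of 2; this lets the modulus in `g-mod` grow with `r`.
mod-double : ∀ {x y e} → x ≡ y [mod2^ e ] → + 2 * x ≡ + 2 * y [mod2^ suc e ]
mod-double {x} {y} {e} (congruent p) =
  congruent (subst₂ _∣ℤ_ (sym (ℤ.pos-* 2 (2 ℕ.^ e))) (distrib x y) (Signed.*-monoʳ-∣ (+ 2) p))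
  where
  distrib : ∀ x y → + 2 * (x - y) ≡ + 2 * x - + 2 * y
  distrib = solve-∀

-- Expanding G as the sum of all powers of 2 x - x ^ (k + 1), this is the contribution of the
-- products with `a` factors -x ^ (k + 1) and `r` factors 2 x.
leading : ℕ → ℕ → ℤ
leading a r = -1ℤ ^ a * + (((a ℕ.+ r) C a) ℕ.* 2 ℕ.^ r)

leading-zeroˡ : ∀ r → leading 0 r ≡ + (2 ℕ.^ r)
leading-zeroˡ r = trans (ℤ.*-identityˡ _) (cong +_ (ℕ.*-identityˡ (2 ℕ.^ r)))

leading-zeroʳ : ∀ a → leading a 0 ≡ -1ℤ ^ a
leading-zeroʳ a rewrite ℕ.+-identityʳ a | nCn≡1 a = ℤ.*-identityʳ (-1ℤ ^ a)

-- Pascal's rule: leading satisfies the recurrence of the coefficients of G exactly.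
leading-suc : ∀ a r → leading (suc a) (suc r) ≡ + 2 * leading (suc a) r - leading a (suc r)
leading-suc a r = begin
  -1ℤ * s * + (((suc a ℕ.+ suc r) C suc a) ℕ.* (2 ℕ.* p))
    ≡⟨ cong (λ c → -1ℤ * s * + (c ℕ.* (2 ℕ.* p)))
         (nCk+nC[k+1]≡[n+1]C[k+1] (a ℕ.+ suc r) a) ⟨
  -1ℤ * s * + ((u ℕ.+ (a ℕ.+ suc r) C suc a) ℕ.* (2 ℕ.* p))
    ≡⟨ cong (λ m → -1ℤ * s * + ((u ℕ.+ m C suc a) ℕ.* (2 ℕ.* p))) (ℕ.+-suc a r) ⟩
  -1ℤ * s * + ((u ℕ.+ v) ℕ.* (2 ℕ.* p))
    ≡⟨ cong (-1ℤ * s *_) (trans (ℤ.pos-* (u ℕ.+ v) (2 ℕ.* p)) (cong (+ (u ℕ.+ v) *_) (ℤ.pos-* 2 p))) ⟩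
  -1ℤ * s * ((+ u + + v) * (+ 2 * + p))
    ≡⟨ regroup s (+ u) (+ v) (+ p) ⟩
  + 2 * (-1ℤ * s * (+ v * + p)) - s * (+ u * (+ 2 * + p))
    ≡⟨ cong₂ (λ x y → + 2 * (-1ℤ * s * x) - s * y) (ℤ.pos-* v p)
         (trans (ℤ.pos-* u (2 ℕ.* p)) (cong (+ u *_) (ℤ.pos-* 2 p))) ⟨
  + 2 * leading (suc a) r - leading a (suc r) ∎
  where
  open ≡-Reasoning
  s = -1ℤ ^ a
  p = 2 ℕ.^ r
  u = (a ℕ.+ suc r) C a
  v = (suc a ℕ.+ r) C suc a
  regroup : ∀ s u v p →
    -1ℤ * s * ((u + v) * (+ 2 * p)) ≡ + 2 * (-1ℤ * s * (v * p)) - s * (u * (+ 2 * p))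
  regroup = solve-∀

leading-vanishes : ∀ a r → leading a r ≡ 0ℤ [mod2^ r ]
leading-vanishes a r = congruent (divides (-1ℤ ^ a * + ((a ℕ.+ r) C a))
  (trans (ℤ.+-identityʳ _) (trans (cong (-1ℤ ^ a *_) (ℤ.pos-* ((a ℕ.+ r) C a) (2 ℕ.^ r)))
    (sym (ℤ.*-assoc (-1ℤ ^ a) _ _)))))

-- Induction on `a`, then on `r`, along the recurrence of G. Passing from `r` to `r + 1` doubles the
-- preceding coefficient, which raises the modulus as required; the subtracted coefficient has the
-- same remainder `r + 1` and so already the right modulus.
g-mod : ∀ {k} a r → r ≤ℕ k →
  g k (r ℕ.+ a ℕ.* suc k) 0 ≡ leading a r [mod2^ r ℕ.+ suc k ]
g-mod {k} zero zero _ = mod-reflexive refl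
g-mod {k} zero (suc r) r<k =
  subst₂ (_≡_[mod2^ suc r ℕ.+ suc k ])
    (trans (sym (ℤ.+-identityʳ _)) (cong (λ z → + 2 * g k (r ℕ.+ 0) 0 - z)
      (sym (g-vanishes k (ℕ.<-≤-trans (ℕ.s≤s (ℕ.≤-reflexive (ℕ.+-identityʳ r))) r<k)))))
    (trans (cong (+ 2 *_) (leading-zeroˡ r))
      (trans (sym (ℤ.pos-* 2 (2 ℕ.^ r))) (sym (leading-zeroˡ (suc r)))))
    (mod-double (g-mod zero r (ℕ.<⇒≤ r<k)))
-- The preceding coefficient has quotient `a` and remainder `k`. Its leading term is divisible by 2
-- ^ k, so its double vanishes modulo 2 ^ (k + 1) and only the sign change of `leading a 0` remains.
g-mod {k} (suc a) zero _ =
  subst₂ (_≡_[mod2^ suc k ])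
    (cong (λ z → + 2 * g k (k ℕ.+ a ℕ.* suc k) 0 - z)
      (trans (sym (g-shift k k (a ℕ.* suc k) 0)) (cong (g k (k ℕ.+ a ℕ.* suc k)) (ℕ.+-identityʳ k))))
    (trans (cong (λ t → 0ℤ - t) (leading-zeroʳ a)) (trans (negate (-1ℤ ^ a)) (sym (leading-zeroʳ (suc a)))))
    (mod-minus
      (mod-double
        (mod-trans (mod-weaken (ℕ.m≤m+n k (suc k)) (g-mod a k ℕ.≤-refl)) (leading-vanishes a k)))
      (g-mod a zero ℕ.z≤n))
  where
  negate : ∀ s → 0ℤ - s ≡ -1ℤ * s
  negate = solve-∀
g-mod {k} (suc a) (suc r) r<k =
  subst₂ (_≡_[mod2^ suc r ℕ.+ suc k ])
    (cong (λ z → + 2 * g k (r ℕ.+ suc a ℕ.* suc k) 0 - z) shifted)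
    (sym (leading-suc a r))
    (mod-minus (mod-double (g-mod (suc a) r (ℕ.<⇒≤ r<k))) (g-mod a (suc r) r<k))
  where
  open ≡-Reasoning
  shifted : g k (suc r ℕ.+ a ℕ.* suc k) 0 ≡ g k (r ℕ.+ suc a ℕ.* suc k) k
  shifted = begin
    g k (suc r ℕ.+ a ℕ.* suc k) 0
      ≡⟨ g-shift k k _ 0 ⟨
    g k (k ℕ.+ (suc r ℕ.+ a ℕ.* suc k)) (k ℕ.+ 0)
      ≡⟨ cong₂ (g k) reorder (ℕ.+-identityʳ k) ⟩
    g k (r ℕ.+ suc a ℕ.* suc k) k ∎
    where
    open +-*-Solver
    reorder : k ℕ.+ (suc r ℕ.+ a ℕ.* suc k) ≡ r ℕ.+ suc a ℕ.* suc k
    reorder = solve 3 (λ k r m → k :+ (con 1 :+ r :+ m) := r :+ (con 1 :+ k :+ m)) refl k r (a ℕ.* suc k)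

-- The 2-adic order

Exactly : ℕ → ℕ → Set
Exactly e m = 2 ℕ.^ e ∣ m × 2 ℕ.^ suc e ∤ m

n<2^n : ∀ n → n <ℕ 2 ℕ.^ n
n<2^n zero    = ℕ.z<s
n<2^n (suc n) = begin-strict
  suc n                 ≤⟨ n<2^n n ⟩
  2 ℕ.^ n               <⟨ ℕ.^-monoʳ-< 2 (ℕ.s≤s (ℕ.s≤s ℕ.z≤n)) (ℕ.n<1+n n) ⟩
  2 ℕ.^ suc n           ∎
  where open ℕ.≤-Reasoning

Exactly⇒≤ : ∀ {d e m} → 2 ℕ.^ d ∣ m → Exactly e m → d ≤ℕ e
Exactly⇒≤ {d} {e} 2^d∣m (_ , 2^[1+e]∤m) =
  ℕ.≮⇒≥ (λ e<d → 2^[1+e]∤m (ℕ∣.∣-trans (2^-mono-∣ e<d) 2^d∣m))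

Exactly-unique : ∀ {d e m} → Exactly d m → Exactly e m → d ≡ e
Exactly-unique p q = ℕ.≤-antisym (Exactly⇒≤ (proj₁ p) q) (Exactly⇒≤ (proj₁ q) p)

-- The search runs downwards: each failed test is the indivisibility needed for the next exponent,
-- and the hypothesis supplies it for the first.
greatestExponent-exact : ∀ m b → 2 ℕ.^ suc b ∤ m → Exactly (greatestExponent m b) m
greatestExponent-exact m zero    2^[1+b]∤m = ℕ∣.1∣ m , 2^[1+b]∤m
greatestExponent-exact m (suc b) 2^[2+b]∤m with 2 ℕ.^ suc b ∣? m
... | yes 2^[1+b]∣m = 2^[1+b]∣m , 2^[2+b]∤m
... | no  2^[1+b]∤m = greatestExponent-exact m b 2^[1+b]∤m

v₂-exact : ∀ m → m ≡ 0 ⊎ ∃[ e ] v₂ m ≡ [ + e ] × Exactly e m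
v₂-exact zero        = inj₁ refl
v₂-exact m@(suc _) = inj₂ (greatestExponent m m , refl ,
  greatestExponent-exact m m
    (λ 2^[1+m]∣m → ℕ.<⇒≱ (n<2^n (suc m)) (ℕ.m≤n⇒m≤1+n (ℕ∣.∣⇒≤ 2^[1+m]∣m))))

Exactly⇒v₂ : ∀ {e m} → Exactly e m → v₂ m ≡ [ + e ]
Exactly⇒v₂ {e} {m} p with v₂-exact m
... | inj₁ refl          = contradiction ((2 ℕ.^ suc e) ℕ∣.∣0) (proj₂ p)
... | inj₂ (d , eq , q) = trans eq (cong (λ d → [ + d ]) (Exactly-unique q p))

v₂-*2^ : ∀ m s → v₂ (m ℕ.* 2 ℕ.^ s) ≡ [ + s ] +⁺ v₂ m
v₂-*2^ m s with v₂-exact m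
... | inj₁ refl = refl
... | inj₂ (e , eq , 2^e∣m , 2^[1+e]∤m) = trans (Exactly⇒v₂ {s ℕ.+ e} (divisible , indivisible))
    (cong ([ + s ] +⁺_) (sym eq))
  where
  instance
    2^s≢0 = ℕ.m^n≢0 2 s
  split : ∀ d → 2 ℕ.^ (s ℕ.+ d) ≡ 2 ℕ.^ d ℕ.* 2 ℕ.^ s
  split d = trans (ℕ.^-distribˡ-+-* 2 s d) (ℕ.*-comm (2 ℕ.^ s) (2 ℕ.^ d))
  divisible : 2 ℕ.^ (s ℕ.+ e) ∣ m ℕ.* 2 ℕ.^ s
  divisible = subst (_∣ m ℕ.* 2 ℕ.^ s) (sym (split e)) (ℕ∣.*-monoˡ-∣ (2 ℕ.^ s) 2^e∣m)
  indivisible : 2 ℕ.^ suc (s ℕ.+ e) ∤ m ℕ.* 2 ℕ.^ s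
  indivisible p = 2^[1+e]∤m (ℕ∣.*-cancelʳ-∣ (2 ℕ.^ s)
    (subst (_∣ m ℕ.* 2 ℕ.^ s) (trans (cong (2 ℕ.^_) (sym (ℕ.+-suc s e))) (split (suc e))) p))

-- Divisibility by 2 ^ e and by 2 ^ (e + 1) depends only on the residue modulo 2 ^ (e + 1).
Exactly-resp-mod : ∀ {x y e} → x ≡ y [mod2^ suc e ] → Exactly e ∣ y ∣ → Exactly e ∣ x ∣
Exactly-resp-mod {x} {y} {e} p (2^e∣y , 2^[1+e]∤y) =
    Signed.∣⇒∣ᵤ {+ (2 ℕ.^ e)} {x}
      (subst (_ ∣ℤ_) (sub-add x y)
        (Signed.∣m∣n⇒∣m+n (_≡_[mod2^_].divides-difference (mod-weaken (ℕ.n≤1+n e) p))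
          (Signed.∣ᵤ⇒∣ {+ (2 ℕ.^ e)} {y} 2^e∣y)))
  , λ 2^[1+e]∣x → 2^[1+e]∤y (Signed.∣⇒∣ᵤ {+ (2 ℕ.^ suc e)} {y}
      (subst (_ ∣ℤ_) (sub-sub x y)
        (Signed.∣m∣n⇒∣m-n (Signed.∣ᵤ⇒∣ {+ (2 ℕ.^ suc e)} {x} 2^[1+e]∣x)
          (_≡_[mod2^_].divides-difference p))))
  where
  sub-add : ∀ x y → x - y + y ≡ x
  sub-add = solve-∀
  sub-sub : ∀ x y → x - (x - y) ≡ y
  sub-sub = solve-∀

Positive-difference : ∀ {x y} → Positive ([ + x ] -⁺ [ + y ]) → y <ℕ x
Positive-difference {x} {y} 0<x-y = ℤ.drop‿+<+
  (subst₂ ℤ._<_ (ℤ.+-identityʳ (+ y)) (add-sub (+ x) (+ y))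
    (ℤ.+-monoʳ-< (+ y) (Extrema.[<]-injective 0<x-y)))
  where
  add-sub : ∀ x y → y + (x - y) ≡ x
  add-sub = solve-∀

-- The ultrametric principle: if `e` is the order of `x`, then 2 ^ (e + 1) divides both `y` and the
-- modulus, so `w` is congruent to `x` modulo 2 ^ (e + 1). The two positivity hypotheses have the
-- shape of the conditions on Δ₁, Δ₂ and on Δ₃, Δ₄.
v₂-dominant : ∀ {w x y E} → w ≡ x - y [mod2^ E ] →
  Positive ([ + E ] -⁺ v₂ ∣ x ∣) → Positive (v₂ ∣ y ∣ -⁺ v₂ ∣ x ∣) →
  v₂ ∣ w ∣ ≡ v₂ ∣ x ∣
v₂-dominant {w} {x} {y} {E} w≡x-y v₂x<E v₂x<v₂y with v₂-exact ∣ x ∣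
-- For `x` zero the first difference evaluates to `⊥±`, which is not positive.
... | inj₁ ∣x∣≡0 rewrite ∣x∣≡0 with Supremum.[ () ] ← v₂x<E
... | inj₂ (e , eq , exact) rewrite eq = Exactly⇒v₂ (Exactly-resp-mod w≡x exact)
  where
  2^[1+e]∣y : 2 ℕ.^ suc e ∣ ∣ y ∣
  2^[1+e]∣y with v₂-exact ∣ y ∣
  ... | inj₁ ∣y∣≡0 rewrite ∣y∣≡0 = _ ℕ∣.∣0
  ... | inj₂ (d , eq′ , exact′) rewrite eq′ =
    ℕ∣.∣-trans (2^-mono-∣ (Positive-difference {d} {e} v₂x<v₂y)) (proj₁ exact′)
  x-y≡x : x - y ≡ x [mod2^ suc e ]
  x-y≡x = congruent (subst (_ ∣ℤ_) (cancel x y)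
    (Signed.∣m⇒∣-m (Signed.∣ᵤ⇒∣ {+ (2 ℕ.^ suc e)} {y} 2^[1+e]∣y)))
    where
    cancel : ∀ x y → - y ≡ x - y - x
    cancel = solve-∀
  w≡x : w ≡ x [mod2^ suc e ]
  w≡x = mod-trans (mod-weaken (Positive-difference v₂x<E) w≡x-y) x-y≡x

∣-1^a*x∣ : ∀ a x → ∣ -1ℤ ^ a * x ∣ ≡ ∣ x ∣
∣-1^a*x∣ a x = trans (ℤ.abs-* (-1ℤ ^ a) x) (trans (cong (ℕ._* ∣ x ∣) (∣-1^a∣ a)) (ℕ.*-identityˡ ∣ x ∣))
  where
  ∣-1^a∣ : ∀ a → ∣ -1ℤ ^ a ∣ ≡ 1
  ∣-1^a∣ zero    = refl
  ∣-1^a∣ (suc a) = trans (ℤ.abs-* -1ℤ (-1ℤ ^ a)) (trans (ℕ.*-identityˡ _) (∣-1^a∣ a))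

∣leading∣ : ∀ a r → ∣ leading a r ∣ ≡ ((a ℕ.+ r) C a) ℕ.* 2 ℕ.^ r
∣leading∣ a r = ∣-1^a*x∣ a (+ (((a ℕ.+ r) C a) ℕ.* 2 ℕ.^ r))

-- Congruences for `B` in the two ranges of `r`

g-mod-shifted : ∀ {k} d a r → r ≤ℕ k →
  g k (d ℕ.+ (r ℕ.+ a ℕ.* suc k)) d ≡ leading a r [mod2^ r ℕ.+ suc k ]
g-mod-shifted {k} d a r r≤k = subst (_≡ leading a r [mod2^ r ℕ.+ suc k ])
  (trans (sym (g-shift k d (r ℕ.+ a ℕ.* suc k) 0)) (cong (g k (d ℕ.+ (r ℕ.+ a ℕ.* suc k))) (ℕ.+-identityʳ d))) (g-mod a r r≤k)

B-large : ∀ {k j n} → j <ℕ k → j <ℕ n → + B k j n ≡ g k n k - g k n (suc k ℕ.+ j)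
B-large {k} {j} {n} j<k j<n = begin
  + B k j n                                  ≡⟨ B-closed j<k n ⟩
  + δ n j + g k n k - g k n (suc k ℕ.+ j)    ≡⟨ cong (λ e → + e + g k n k - g k n (suc k ℕ.+ j)) (δ-off (ℕ.>⇒≢ j<n)) ⟩
  0ℤ + g k n k - g k n (suc k ℕ.+ j)         ≡⟨ cong (_- g k n (suc k ℕ.+ j)) (ℤ.+-identityˡ (g k n k)) ⟩
  g k n k - g k n (suc k ℕ.+ j)              ∎
  where open ≡-Reasoning

-- s stands for r + 1, so that r = -1 is included.
B-low : ∀ {j d s} a → s ≤ℕ j → let k = suc (j ℕ.+ d) in
  + B k j (k ℕ.+ (s ℕ.+ suc a ℕ.* suc k)) ≡
  leading (suc a) s - leading a (suc (s ℕ.+ d)) [mod2^ s ℕ.+ suc k ]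
B-low {j} {d} {s} a s≤j =
  mod-trans (mod-reflexive (B-large j<k (ℕ.<-≤-trans j<k (ℕ.m≤m+n k _))))
    (mod-minus
      (g-mod-shifted k (suc a) s (ℕ.≤-trans s≤j (ℕ.<⇒≤ j<k)))
      -- Since `s ≤ j`, taking j + 1 from the remainder `s` borrows a block of k + 1. This leaves
      -- quotient `a` and remainder s + k - j = s + d + 1.
      (subst (λ n → g k n (suc k ℕ.+ j) ≡ leading a (suc (s ℕ.+ d)) [mod2^ s ℕ.+ suc k ]) reorder
        (mod-weaken (ℕ.+-monoˡ-≤ (suc k) (ℕ.m≤n⇒m≤1+n (ℕ.m≤m+n s d)))
          (g-mod-shifted (suc k ℕ.+ j) a (suc (s ℕ.+ d)) (ℕ.s≤s (ℕ.+-monoˡ-≤ d s≤j))))))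
  where
  k = suc (j ℕ.+ d)
  j<k : j <ℕ k
  j<k = ℕ.s≤s (ℕ.m≤m+n j d)
  open +-*-Solver
  reorder : suc k ℕ.+ j ℕ.+ (suc (s ℕ.+ d) ℕ.+ a ℕ.* suc k) ≡ k ℕ.+ (s ℕ.+ suc a ℕ.* suc k)
  reorder = solve 4 (λ j d s m →
    con 2 :+ (j :+ d) :+ j :+ (con 1 :+ (s :+ d) :+ m) :=
    con 1 :+ (j :+ d) :+ (s :+ (con 2 :+ (j :+ d) :+ m))) refl j d s (a ℕ.* suc k)

-- Here `d` is r - j. Lowering the index by `k` leaves quotient `a` and remainder r + 1; lowering it
-- by k + 1 + j leaves quotient `a` and remainder `d`, with no borrow. The smaller remainder `d`
-- fixes the common modulus.
B-high : ∀ {k j d} a → j ℕ.+ d <ℕ k →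
  + B k j (j ℕ.+ d ℕ.+ suc a ℕ.* suc k) ≡
  leading a (suc (j ℕ.+ d)) - leading a d [mod2^ d ℕ.+ suc k ]
B-high {k} {j} {d} a j+d<k =
  mod-trans (mod-reflexive (B-large j<k (ℕ.<-≤-trans j<k k≤n)))
    (mod-minus
      (subst (λ n → g k n k ≡ leading a (suc (j ℕ.+ d)) [mod2^ d ℕ.+ suc k ]) reorder₁
        (mod-weaken (ℕ.+-monoˡ-≤ (suc k) (ℕ.m≤n⇒m≤1+n (ℕ.m≤n+m d j)))
          (g-mod-shifted k a (suc (j ℕ.+ d)) j+d<k)))
      (subst (λ n → g k n (suc k ℕ.+ j) ≡ leading a d [mod2^ d ℕ.+ suc k ]) reorder₂
        (g-mod-shifted (suc k ℕ.+ j) a d (ℕ.≤-trans (ℕ.m≤n+m d j) (ℕ.<⇒≤ j+d<k)))))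
  where
  n = j ℕ.+ d ℕ.+ suc a ℕ.* suc k
  j<k : j <ℕ k
  j<k = ℕ.≤-<-trans (ℕ.m≤m+n j d) j+d<k
  open +-*-Solver
  reorder₁ : k ℕ.+ (suc (j ℕ.+ d) ℕ.+ a ℕ.* suc k) ≡ n
  reorder₁ = solve 4 (λ k j d m → k :+ (con 1 :+ (j :+ d) :+ m) := j :+ d :+ (con 1 :+ k :+ m))
    refl k j d (a ℕ.* suc k)
  reorder₂ : suc k ℕ.+ j ℕ.+ (d ℕ.+ a ℕ.* suc k) ≡ n
  reorder₂ = solve 4 (λ k j d m → con 1 :+ k :+ j :+ (d :+ m) := j :+ d :+ (con 1 :+ k :+ m))
    refl k j d (a ℕ.* suc k)
  k≤n : k ≤ℕ n
  k≤n = subst (k ≤ℕ_) reorder₁ (ℕ.m≤m+n k _)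

-- The order of `B` in each case

v₂-odd : ∀ {w x} → w ≡ x [mod2^ 1 ] → ∣ x ∣ ≡ 1 → v₂ ∣ w ∣ ≡ [ 0ℤ ]
v₂-odd w≡x ∣x∣≡1 = Exactly⇒v₂ (Exactly-resp-mod w≡x
  (subst (Exactly 0) (sym ∣x∣≡1) (ℕ∣.∣-refl , from-no (2 ∣? 1))))

leading-even : ∀ a r → leading a (suc r) ≡ 0ℤ [mod2^ 1 ]
leading-even a r = mod-weaken (ℕ.s≤s ℕ.z≤n) (leading-vanishes a (suc r))

∣leading-zeroʳ∣ : ∀ a → ∣ leading a 0 ∣ ≡ 1
∣leading-zeroʳ∣ a = trans (cong ∣_∣ (trans (leading-zeroʳ a) (sym (ℤ.*-identityʳ (-1ℤ ^ a))))) (∣-1^a*x∣ a 1ℤ)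

≤-1⇒< : ∀ {i j} → i ≤ j - 1ℤ → i ℤ.< j
≤-1⇒< {i} {j} i≤j-1 = ℤ.i≤pred[j]⇒i<j (subst (i ≤_) (ℤ.+-comm j -1ℤ) i≤j-1)

index : ∀ {k n} a r → + n ≡ + a * (+ k + 1ℤ) + + r → n ≡ a ℕ.* suc k ℕ.+ r
index {k} a r eq = ℤ.+-injective (trans eq (cong (_+ + r)
  (trans (cong (λ m → + a * + m) (ℕ.+-comm k 1)) (sym (ℤ.pos-* a (suc k))))))

-- A negative quotient would force r = n - a (k + 1) ≥ k + 1, against the upper bound on `r`.
nonnegative-quotient : ∀ {k n} a {r} → + n ≡ a * (+ k + 1ℤ) + r → r ≤ + k - 1ℤ → ∃[ b ] a ≡ + b
nonnegative-quotient (+ b) _ _ = b , refl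
nonnegative-quotient {k} {n} -[1+ m ] {r} eq r≤k-1 =
  contradiction (subst (ℤ._< + k) (sym n+[1+m][1+k]≡r) (≤-1⇒< r≤k-1)) λ
    { (ℤ.+<+ <k) → ℕ.<⇒≱ <k
        (ℕ.≤-trans (ℕ.n≤1+n k) (ℕ.≤-trans (ℕ.m≤m+n (suc k) (m ℕ.* suc k)) (ℕ.m≤n+m _ n))) }
  where
  cancel : ∀ b c r → - b * c + r + b * c ≡ r
  cancel = solve-∀
  n+[1+m][1+k]≡r : + (n ℕ.+ suc m ℕ.* suc k) ≡ r
  n+[1+m][1+k]≡r = trans
    (cong₂ _+_ eq (trans (ℤ.pos-* (suc m) (suc k)) (cong (λ c → + suc m * + c) (sym (ℕ.+-comm k 1)))))
    (cancel (+ suc m) (+ k + 1ℤ) r)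

-- The index is (a + 1)(k + 1) - 1, that is, r = -1. In `B-low` with `s = 0` the first term is 1 or
-- -1 and the second is even; `a = 0` is the index `k`, below the range of `B-low`.
B-odd-at-minus-one : ∀ {k j} a → j <ℕ k → v₂ (B k j (k ℕ.+ a ℕ.* suc k)) ≡ [ 0ℤ ]
B-odd-at-minus-one {k} zero j<k rewrite ℕ.+-identityʳ k | B-at-k j<k = refl
B-odd-at-minus-one {j = j} (suc a) j<k with d , refl ← ℕ.m≤n⇒∃[o]m+o≡n j<k =
  v₂-odd
    (mod-trans (mod-weaken (ℕ.s≤s ℕ.z≤n) (B-low {j} {d} {0} a ℕ.z≤n))
      (mod-minus (mod-reflexive {leading (suc a) 0} refl) (leading-even a d)))
    (trans (cong ∣_∣ (ℤ.+-identityʳ (leading (suc a) 0))) (∣leading-zeroʳ∣ (suc a)))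

-- In `B-high` with `d = 0` the first term is even and the second is 1 or -1; `a = 0` is the initial
-- value 1.
B-odd-at-j : ∀ {k j} a → j <ℕ k → v₂ (B k j (j ℕ.+ a ℕ.* suc k)) ≡ [ 0ℤ ]
B-odd-at-j {k} {j} zero j<k rewrite ℕ.+-identityʳ j | B-initial j j<k | δ-diag j = refl
B-odd-at-j {k} {j} (suc a) j<k =
  v₂-odd
    (subst (λ r → + B k j (r ℕ.+ suc a ℕ.* suc k) ≡ 0ℤ - leading a 0 [mod2^ 1 ]) (ℕ.+-identityʳ j)
      (mod-trans
        (mod-weaken (ℕ.s≤s ℕ.z≤n)
          (B-high {k} {j} {0} a (subst (_<ℕ k) (sym (ℕ.+-identityʳ j)) j<k)))
        (mod-minus (leading-even a (j ℕ.+ 0)) (mod-reflexive refl))))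
    (trans (cong ∣_∣ (ℤ.+-identityˡ (- leading a 0))) (trans (ℤ.∣-i∣≡∣i∣ (leading a 0)) (∣leading-zeroʳ∣ a)))

-- The first term of `B-low` dominates, with `s = r + 1`: Δ₁ compares its order with the exponent of
-- the modulus, Δ₂ with the order of the second term.
v₂-B-low : ∀ {j d r} a → r <ℕ j → let k = suc (j ℕ.+ d); A = + suc (suc a) in
  Positive (Δ₁ k j A (+ r)) → Positive (Δ₂ k j A (+ r)) →
  v₂ (B k j (suc (suc a) ℕ.* suc k ℕ.+ r)) ≡ [ + r + 1ℤ ] +⁺ v₂ (binom (A + + r) (A - 1ℤ))
v₂-B-low {j} {d} {r} a r<j 0<Δ₁ 0<Δ₂ = begin
  v₂ (B k j (suc (suc a) ℕ.* suc k ℕ.+ r))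
    ≡⟨ cong (λ n → v₂ (B k j n)) index-split ⟩
  v₂ (B k j (k ℕ.+ (suc r ℕ.+ suc a ℕ.* suc k)))
    ≡⟨ v₂-dominant {x = leading (suc a) (suc r)} {leading a (suc (suc r ℕ.+ d))} (B-low a r<j)
         (subst₂ (λ E x → Positive ([ E ] -⁺ v₂ x)) exponent (sym ∣x∣) 0<Δ₁)
         (subst₂ (λ y x → Positive (v₂ y -⁺ v₂ x)) (sym ∣y∣) (sym ∣x∣) 0<Δ₂) ⟩
  v₂ ∣ leading (suc a) (suc r) ∣
    ≡⟨ cong v₂ ∣x∣ ⟩
  v₂ (binom (A + + r) (A - 1ℤ) ℕ.* 2^ (+ r + 1ℤ))
    ≡⟨ v₂-*2^ (binom (A + + r) (A - 1ℤ)) (r ℕ.+ 1) ⟩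
  [ + r + 1ℤ ] +⁺ v₂ (binom (A + + r) (A - 1ℤ)) ∎
  where
  open ≡-Reasoning
  k = suc (j ℕ.+ d)
  A = + suc (suc a)
  exponent : + r + + k + + 2 ≡ + (suc r ℕ.+ suc k)
  exponent = lemma (+ r) (+ k)
    where
    lemma : ∀ r k → r + k + + 2 ≡ 1ℤ + r + (1ℤ + k)
    lemma = solve-∀
  ∣x∣ : ∣ leading (suc a) (suc r) ∣ ≡ binom (A + + r) (A - 1ℤ) ℕ.* 2^ (+ r + 1ℤ)
  ∣x∣ = trans (∣leading∣ (suc a) (suc r))
    (cong₂ (λ m e → (m C suc a) ℕ.* 2 ℕ.^ e) (ℕ.+-suc (suc a) r) (ℕ.+-comm 1 r))
  ∣y∣ : ∣ leading a (suc (suc r ℕ.+ d)) ∣ ≡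
    binom (A + + r + + k - + j - 1ℤ) (A - + 2) ℕ.* 2^ (+ r + + k + 1ℤ - + j)
  ∣y∣ = trans (∣leading∣ a (suc (suc r ℕ.+ d)))
    (cong₂ (λ m e → binom m (+ a) ℕ.* 2^ e)
      (sym (top (+ a) (+ r) (+ j) (+ d))) (sym (power (+ r) (+ j) (+ d))))
    where
    top : ∀ a r j d → + 2 + a + r + (1ℤ + (j + d)) - j - 1ℤ ≡ a + (+ 2 + (r + d))
    top = solve-∀
    power : ∀ r j d → r + (1ℤ + (j + d)) + 1ℤ - j ≡ + 2 + (r + d)
    power = solve-∀
  index-split : suc (suc a) ℕ.* suc k ℕ.+ r ≡ k ℕ.+ (suc r ℕ.+ suc a ℕ.* suc k)
  index-split = solve 3 (λ k r m →
    con 1 :+ k :+ (con 1 :+ k :+ m) :+ r := k :+ (con 1 :+ r :+ (con 1 :+ k :+ m)))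
    refl k r (a ℕ.* suc k)
    where
    open +-*-Solver

v₂-B-high : ∀ {k j d} a → let r = j ℕ.+ suc d; A = + suc a in r <ℕ k →
  Positive (Δ₃ k j A (+ r)) → Positive (Δ₄ k j A (+ r)) →
  v₂ (B k j (suc a ℕ.* suc k ℕ.+ r)) ≡
  [ + r - + j ] +⁺ v₂ (binom (A + + r - + j - 1ℤ) (A - 1ℤ))
v₂-B-high {k} {j} {d} a r<k 0<Δ₃ 0<Δ₄ = begin
  v₂ (B k j (suc a ℕ.* suc k ℕ.+ r))
    ≡⟨ cong (λ n → v₂ (B k j n)) (ℕ.+-comm (suc a ℕ.* suc k) r) ⟩
  v₂ (B k j (r ℕ.+ suc a ℕ.* suc k))
    -- Here the subtracted term of `B-high` dominates, so p - q is read as -q - (-p); the sign does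
    -- not affect the order.
    ≡⟨ v₂-dominant {x = - leading a (suc d)} { - leading a (suc r)}
         (mod-trans (B-high a r<k) (mod-reflexive (swap (leading a (suc r)) (leading a (suc d)))))
         (subst₂ (λ E x → Positive ([ E ] -⁺ v₂ x)) (exponent (+ j) (+ d) (+ k)) (sym ∣x∣) 0<Δ₃)
         (subst₂ (λ y x → Positive (v₂ y -⁺ v₂ x)) (sym ∣y∣) (sym ∣x∣) 0<Δ₄) ⟩
  v₂ ∣ - leading a (suc d) ∣
    ≡⟨ cong v₂ ∣x∣ ⟩
  v₂ (c ℕ.* 2^ (+ r - + j))
    ≡⟨ cong (λ e → v₂ (c ℕ.* 2^ e)) (power (+ j) (+ d)) ⟩
  v₂ (c ℕ.* 2 ℕ.^ suc d)
    ≡⟨ v₂-*2^ c (suc d) ⟩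
  [ + suc d ] +⁺ v₂ c
    ≡⟨ cong (λ e → [ e ] +⁺ v₂ c) (power (+ j) (+ d)) ⟨
  [ + r - + j ] +⁺ v₂ c ∎
  where
  open ≡-Reasoning
  r = j ℕ.+ suc d
  A = + suc a
  c = binom (A + + r - + j - 1ℤ) (A - 1ℤ)
  swap : ∀ p q → p - q ≡ - q - - p
  swap = solve-∀
  exponent : ∀ j d k → j + (1ℤ + d) + k + 1ℤ - j ≡ 1ℤ + d + (1ℤ + k)
  exponent = solve-∀
  power : ∀ j d → j + (1ℤ + d) - j ≡ 1ℤ + d
  power = solve-∀
  ∣x∣ : ∣ - leading a (suc d) ∣ ≡ c ℕ.* 2^ (+ r - + j)
  ∣x∣ = trans (ℤ.∣-i∣≡∣i∣ (leading a (suc d))) (trans (∣leading∣ a (suc d))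
    (cong₂ (λ m e → binom m (+ a) ℕ.* 2^ e)
      (sym (top (+ a) (+ j) (+ d))) (sym (power (+ j) (+ d)))))
    where
    top : ∀ a j d → 1ℤ + a + (j + (1ℤ + d)) - j - 1ℤ ≡ a + (1ℤ + d)
    top = solve-∀
  ∣y∣ : ∣ - leading a (suc r) ∣ ≡ binom (A + + r) (A - 1ℤ) ℕ.* 2^ (+ r + 1ℤ)
  ∣y∣ = trans (ℤ.∣-i∣≡∣i∣ (leading a (suc r))) (trans (∣leading∣ a (suc r))
    (cong₂ (λ m e → (m C a) ℕ.* 2 ℕ.^ e) (ℕ.+-suc a r) (ℕ.+-comm 1 r)))

theorem6 : (k j : ℕ) → 2 ≤ℕ k → j <ℕ k →
    (n : ℕ) (a r : ℤ) → + n ≡ a * (+ k + 1ℤ) + r → -1ℤ ≤ r → r ≤ + k - 1ℤ →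
    ((r ≡ -1ℤ ⊎ r ≡ + j) → v₂ (B k j n) ≡ [ 0ℤ ])
    × (0ℤ ≤ r → r ≤ + j - 1ℤ → + 2 ≤ a →
    Positive (Δ₁ k j a r) → Positive (Δ₂ k j a r) →
    v₂ (B k j n) ≡ [ r + 1ℤ ] +⁺ v₂ (binom (a + r) (a - 1ℤ)))
    × (+ j + 1ℤ ≤ r → r ≤ + k - 1ℤ → 1ℤ ≤ a →
    Positive (Δ₃ k j a r) → Positive (Δ₄ k j a r) →
    v₂ (B k j n) ≡ [ r - + j ] +⁺ v₂ (binom (a + r - + j - 1ℤ) (a - 1ℤ)))
theorem6 k j _ j<k n a r eq _ r≤k-1 = odd , low , high
  where
  odd : r ≡ -1ℤ ⊎ r ≡ + j → v₂ (B k j n) ≡ [ 0ℤ ]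
  odd r≡ with nonnegative-quotient a eq r≤k-1
  -- Quotient 0 and remainder -1 would give the index -1.
  odd (inj₁ refl) | zero , refl = contradiction eq λ ()
  odd (inj₁ refl) | suc b , refl = subst (λ n → v₂ (B k j n) ≡ [ 0ℤ ])
      (sym (ℕ.suc-injective (trans (index (suc b) 0 1+n) (ℕ.+-identityʳ _))))
      (B-odd-at-minus-one b j<k)
    where
    restore : ∀ x → 1ℤ + (x + -1ℤ) ≡ x + 0ℤ
    restore = solve-∀
    -- `index` expects a natural remainder, so it is applied to n + 1, whose remainder is 0.
    1+n : + suc n ≡ + suc b * (+ k + 1ℤ) + + 0
    1+n = trans (cong ℤ.suc eq) (restore (+ suc b * (+ k + 1ℤ)))
  odd (inj₂ refl) | b , refl = subst (λ n → v₂ (B k j n) ≡ [ 0ℤ ])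
    (sym (trans (index b j eq) (ℕ.+-comm (b ℕ.* suc k) j))) (B-odd-at-j b j<k)

  low : 0ℤ ≤ r → r ≤ + j - 1ℤ → + 2 ≤ a → Positive (Δ₁ k j a r) → Positive (Δ₂ k j a r) →
    v₂ (B k j n) ≡ [ r + 1ℤ ] +⁺ v₂ (binom (a + r) (a - 1ℤ))
  low (ℤ.+≤+ {n = r′} _) r≤j-1 (ℤ.+≤+ (ℕ.s≤s (ℕ.s≤s {n = b} _))) 0<Δ₁ 0<Δ₂
    with d , refl ← ℕ.m≤n⇒∃[o]m+o≡n j<k | refl ← index {k} {n} (suc (suc b)) r′ eq
    = v₂-B-low {j} {d} b (ℤ.drop‿+<+ (≤-1⇒< r≤j-1)) 0<Δ₁ 0<Δ₂

  high : + j + 1ℤ ≤ r → r ≤ + k - 1ℤ → 1ℤ ≤ a → Positive (Δ₃ k j a r) → Positive (Δ₄ k j a r) →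
    v₂ (B k j n) ≡ [ r - + j ] +⁺ v₂ (binom (a + r - + j - 1ℤ) (a - 1ℤ))
  high (ℤ.+≤+ {n = r′} j+1≤r) _ (ℤ.+≤+ (ℕ.s≤s {n = b} _)) 0<Δ₃ 0<Δ₄
    with d , eq′ ← ℕ.m≤n⇒∃[o]m+o≡n j+1≤r
    with refl ← trans (sym (ℕ.+-assoc j 1 d)) eq′ | refl ← index {k} {n} (suc b) r′ eq
    = v₂-B-high b (ℤ.drop‿+<+ (≤-1⇒< r≤k-1)) 0<Δ₃ 0<Δ₄
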